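{- Let $m\geq 1$, $a\ge 1$ and $n,p>1$ be integers, and let $G$ be an $r$-regular graph of order $m$. If $n\equiv 0\pmod 2$ or $apm\equiv 1\pmod 2$, then $G\circ aH_{n,p}$ is distance magic.
   Context: A graph $G$ on $v$ vertices is distance magic if there is a bijection $f:V(G)\to\{1,\ldots,v\}$ and a constant $k$ such that for every vertex $x$, $\sum_{y\in N(x)}f(y)=k$, where $N(x)$ is the set of neighbours of $x$. $H_{n,p}$ denotes the complete multipartite graph with $p$ partite sets each of size $n$; $aH$ denotes the disjoint union of $a$ copies of $H$. The lexicographic product $G\circ H$ has vertex set $V(G)\times V(H)$, with $(g,h)$ adjacent to $(g',h')$ iff either $gg'\in E(G)$, or $g=g'$ and $hh'\in E(H)$. -}

module Defs where

open import Data.Fin using (Fin; toℕ)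
open import Data.Fin.Properties using (*↔×) renaming (_≟_ to _≟F_)
open import Data.List using (List; allFin; filter; length; map; sum)
open import Data.Nat using (ℕ; suc; _*_)
open import Data.Product using (_×_; _,_; Σ-syntax; ∃-syntax)
open import Data.Product.Function.NonDependent.Propositional using (_×-↔_)
open import Data.Sum using (_⊎_; inj₁; inj₂)
open import Function using (_∘_)
open import Function.Bundles using (_↔_; _⤖_; Inverse; Bijection)
open import Function.Construct.Composition using (_↔-∘_)
open import Function.Construct.Identity using (↔-id)
open import Function.Construct.Symmetry using (↔-sym)
open import Function.Properties.Inverse using (↔⇒↣)
open import Relation.Binary.Definitions using (Decidable; DecidableEquality; Irreflexive; Symmetric)
open import Relation.Binary.PropositionalEquality using (_≡_; _≢_; refl; sym; ≢-sym)
open import Relation.Nullary.Decidable using (¬?; via-injection; _×-dec_; _⊎-dec_)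

record SimpleGraph (v : ℕ) : Set₁ where
  infix 4 _~_ _~?_
  field
    Vertex      : Set
    enumeration : Vertex ↔ Fin v
    _~_         : Vertex → Vertex → Set
    _~?_        : Decidable _~_
    ~-sym       : Symmetric _~_
    ~-irrefl    : Irreflexive _≡_ _~_

  _≟V_ : DecidableEquality Vertex
  _≟V_ = via-injection (↔⇒↣ enumeration) _≟F_

  vertices : List Vertex
  vertices = map (Inverse.from enumeration) (allFin v)

  N : Vertex → List Vertex
  N x = filter (x ~?_) vertices

  degree : Vertex → ℕ
  degree = length ∘ N

open SimpleGraph

Regular : ∀ {v} → ℕ → SimpleGraph v → Set
Regular r G = ∀ x → degree G x ≡ r

-- A labelling by {1,…,v} is a bijection to Fin v, with i : Fin v standing for
-- the label 1 + toℕ i.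
label : ∀ {v} {V : Set} → V ⤖ Fin v → V → ℕ
label f x = suc (toℕ (Bijection.to f x))

DistanceMagic : ∀ {v} → SimpleGraph v → Set
DistanceMagic {v} G =
  Σ[ f ∈ (Vertex G ⤖ Fin v) ] ∃[ k ] (∀ x → sum (map (label f) (N G x)) ≡ k)

-- H[ n , p ] has p partite sets of size n; the vertex (i , j) is the j-th
-- element of the i-th partite set.
H[_,_] : (n p : ℕ) → SimpleGraph (p * n)
H[ n , p ] = record
  { Vertex      = Fin p × Fin n
  ; enumeration = ↔-sym *↔×
  ; _~_         = λ (i , _) (i′ , _) → i ≢ i′
  ; _~?_        = λ (i , _) (i′ , _) → ¬? (i ≟F i′)
  ; ~-sym       = ≢-sym
  ; ~-irrefl    = λ { refl i≢i → i≢i refl }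
  }

enumeration-× : ∀ {m n} {A B : Set} → A ↔ Fin m → B ↔ Fin n → (A × B) ↔ Fin (m * n)
enumeration-× e e′ = ↔-sym *↔× ↔-∘ (e ×-↔ e′)

copies : ∀ {v} (a : ℕ) → SimpleGraph v → SimpleGraph (a * v)
copies a H = record
  { Vertex      = Fin a × Vertex H
  ; enumeration = enumeration-× (↔-id (Fin a)) (enumeration H)
  ; _~_         = λ (c , h) (c′ , h′) → c ≡ c′ × _~_ H h h′
  ; _~?_        = λ (c , h) (c′ , h′) → (c ≟F c′) ×-dec (_~?_ H h h′)
  ; ~-sym       = λ (c≡c′ , h~h′) → sym c≡c′ , ~-sym H h~h′
  ; ~-irrefl    = λ { refl (_ , h~h) → ~-irrefl H refl h~h }
  }

lexProduct : ∀ {v w} → SimpleGraph v → SimpleGraph w → SimpleGraph (v * w)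
lexProduct G H = record
  { Vertex      = Vertex G × Vertex H
  ; enumeration = enumeration-× (enumeration G) (enumeration H)
  ; _~_         = λ (g , h) (g′ , h′) → _~_ G g g′ ⊎ (g ≡ g′ × _~_ H h h′)
  ; _~?_        = λ (g , h) (g′ , h′) →
                    (_~?_ G g g′) ⊎-dec (_≟V_ G g g′ ×-dec _~?_ H h h′)
  ; ~-sym       = λ { (inj₁ g~g′)          → inj₁ (~-sym G g~g′)
                    ; (inj₂ (g≡g′ , h~h′)) → inj₂ (sym g≡g′ , ~-sym H h~h′) }
  ; ~-irrefl    = λ { refl (inj₁ g~g)       → ~-irrefl G refl g~g
                    ; refl (inj₂ (_ , h~h)) → ~-irrefl H refl h~h }
  }

{-# OPTIONS --safe #-}

-- Call the n-element partite sets of the copies of H[ n , p ] blocks; there are N = m a p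
-- of them.  If the labels can be distributed so that all blocks have the same sum Q, then
-- every neighbourhood, being a union of r a p + (p - 1) blocks, has the same sum.
-- Give the j-th elements of the blocks the labels 1 + jN + σⱼ(b), where σⱼ permutes the
-- block indices b = 0, …, N - 1; it remains to make ∑ⱼ σⱼ(b) independent of b.
-- Two permutations, the identity and the reversal, achieve this, and so do three when N is
-- odd; pairs of the first kind can be appended at will.
module Submission where

open import Defs
import Algebra.Properties.Semiring.Sum
open import Data.Bool using (Bool; true; false; not; _∧_; _∨_)
open import Data.Fin using (Fin; zero; suc; toℕ; fromℕ<; opposite; join; splitAt; quotRem; remQuot; _↑ˡ_; _↑ʳ_)
open import Data.Fin.Permutation using (Permutation′; _⟨$⟩ʳ_; _⟨$⟩ˡ_; inverseˡ; inverseʳ; reverse; cast-id)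
open import Data.Fin.Properties using (_≟_; any?; injective⇒≤; punchOut-injective; opposite-prop; toℕ<n; toℕ≤pred[n]; toℕ-injective; toℕ-fromℕ<; fromℕ<-injective; splitAt-↑ˡ; splitAt-↑ʳ; toℕ-cast; toℕ-combine; toℕ-↑ˡ; toℕ-↑ʳ; +↔⊎; *↔×; join-splitAt)
open import Data.List as List using (List; filter; length; map)
open import Data.List.Properties using (map-tabulate)
open import Data.Nat using (ℕ; zero; suc; _+_; _*_; _∸_; _≤_; _<_; s≤s; _%_; _/_; ⌊_/2⌋)
open import Data.Nat.DivMod using (m≡m%n+[m/n]*n; m%n<n)
import Data.Nat.ListAction as ListAction
open import Data.Nat.Properties using (+-*-semiring; +-assoc; +-comm; +-identityʳ; +-mono-≤; *-assoc; *-comm; *-identityˡ; *-zeroʳ; suc-injective; m+[n∸m]≡n; 1+n≰n; 1+n≢n; <⇒≤; n≡⌊n+n/2⌋; n≡⌈n+n/2⌉)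
open import Data.Nat.Tactic.RingSolver using (solve-∀)
open import Data.Product as Product using (_×_; _,_; proj₁; proj₂)
open import Data.Product.Function.NonDependent.Propositional using (_×-↔_)
open import Data.Sum using (_⊎_; inj₁; inj₂; [_,_]′; map₂; swap)
open import Data.Sum.Properties using (swap-↔)
open import Data.Vec.Functional using (Vector; []; _∷_)
open import Function using (_∘_; id)
open import Function.Bundles using (_↔_; Injection; Inverse; mk↔ₛ′)
open import Function.Construct.Composition using (_↔-∘_)
open import Function.Construct.Identity using (↔-id)
open import Function.Construct.Symmetry using (↔-sym)
open import Function.Definitions using (Injective; StrictlySurjective)
open import Function.Properties.Inverse using (↔⇒↣; ↔⇒⤖)
open import Relation.Binary.PropositionalEquality using (_≡_; _≢_; _≗_; refl; sym; trans; cong; cong₂; subst; subst₂; module ≡-Reasoning)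
open import Relation.Nullary using (¬_; Dec; does; yes; no; contradiction)
open import Relation.Unary using (Decidable)

open Algebra.Properties.Semiring.Sum +-*-semiring using (sum; sum-syntax; sum-cong-≗; ∑-distrib-+; *-distribˡ-sum; *-distribʳ-sum)
open SimpleGraph
open ≡-Reasoning

-- Finite sums

sum-const : ∀ n x → ∑[ i < n ] x ≡ n * x
sum-const zero    x = refl
sum-const (suc n) x = cong (x +_) (sum-const n x)

sum-↑ : ∀ m {n} (f : Vector ℕ (m + n)) → sum f ≡ sum (f ∘ (_↑ˡ n)) + sum (f ∘ (m ↑ʳ_))
sum-↑ zero    f = refl
sum-↑ (suc m) f = trans (cong (f zero +_) (sum-↑ m (f ∘ suc))) (sym (+-assoc (f zero) _ _))

ι : Bool → ℕ
ι true  = 1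
ι false = 0

sum-ι-≟ : ∀ {n} (x : Fin n) → ∑[ i < n ] ι (does (x ≟ i)) ≡ 1
sum-ι-≟ {suc n} zero    = cong suc (trans (sum-const n 0) (*-zeroʳ n))
sum-ι-≟ {suc n} (suc x) = sum-ι-≟ x

ι-not : ∀ b → ι (not b) + ι b ≡ 1
ι-not true  = refl
ι-not false = refl

sum-ι-≢ : ∀ {n} (x : Fin (suc n)) → ∑[ i < suc n ] ι (not (does (x ≟ i))) ≡ n
sum-ι-≢ {n} x = suc-injective (begin
  suc (∑[ i < suc n ] ι (not (does (x ≟ i))))
    ≡⟨ +-comm 1 _ ⟩
  ∑[ i < suc n ] ι (not (does (x ≟ i))) + 1
    ≡⟨ cong (∑[ i < suc n ] ι (not (does (x ≟ i))) +_) (sym (sum-ι-≟ x)) ⟩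
  ∑[ i < suc n ] ι (not (does (x ≟ i))) + ∑[ i < suc n ] ι (does (x ≟ i))
    ≡⟨ sym (∑-distrib-+ (λ i → ι (not (does (x ≟ i)))) (λ i → ι (does (x ≟ i)))) ⟩
  ∑[ i < suc n ] (ι (not (does (x ≟ i))) + ι (does (x ≟ i)))
    ≡⟨ sum-cong-≗ (λ i → ι-not (does (x ≟ i))) ⟩
  ∑[ i < suc n ] 1
    ≡⟨ trans (sum-const (suc n) 1) (*-comm (suc n) 1) ⟩
  1 * suc n
    ≡⟨ *-identityˡ (suc n) ⟩
  suc n ∎)

-- Summation follows the enumeration, as `vertices` does, so sums over neighbour lists become such
-- sums without any reordering.
total : ∀ {n} {A : Set} → A ↔ Fin n → (A → ℕ) → ℕ
total e w = sum (w ∘ Inverse.from e)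

total-cong : ∀ {n} {A : Set} (e : A ↔ Fin n) {w w′ : A → ℕ} → w ≗ w′ → total e w ≡ total e w′
total-cong e w≗w′ = sum-cong-≗ (w≗w′ ∘ Inverse.from e)

total-*ʳ : ∀ {n} {A : Set} (e : A ↔ Fin n) (w : A → ℕ) c → total e (λ x → w x * c) ≡ total e w * c
total-*ʳ e w c = sym (*-distribʳ-sum c (w ∘ Inverse.from e))

total-*ˡ : ∀ {n} {A : Set} (e : A ↔ Fin n) c (w : A → ℕ) → total e (λ x → c * w x) ≡ c * total e w
total-*ˡ e c w = sym (*-distribˡ-sum c (w ∘ Inverse.from e))

total-+ : ∀ {n} {A : Set} (e : A ↔ Fin n) (w w′ : A → ℕ) →
          total e (λ x → w x + w′ x) ≡ total e w + total e w′
total-+ e w w′ = ∑-distrib-+ (w ∘ Inverse.from e) (w′ ∘ Inverse.from e)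

total-*↔× : ∀ m {n} (w : Fin m × Fin n → ℕ) →
            total (↔-sym *↔×) w ≡ ∑[ i < m ] ∑[ j < n ] w (i , j)
total-*↔× zero        w = refl
total-*↔× (suc m) {n} w = begin
  sum (w ∘ remQuot n)
    ≡⟨ sum-↑ n (w ∘ remQuot n) ⟩
  ∑[ j < n ] w (remQuot {suc m} n (j ↑ˡ (m * n))) + ∑[ k < m * n ] w (remQuot {suc m} n (n ↑ʳ k))
    ≡⟨ cong₂ _+_
         (sum-cong-≗ λ j → cong (λ s → w (remQuot′ s)) (splitAt-↑ˡ n j (m * n)))
         (sum-cong-≗ λ k → cong (λ s → w (remQuot′ s)) (splitAt-↑ʳ n (m * n) k)) ⟩
  ∑[ j < n ] w (zero , j) + total (↔-sym *↔×) (λ (i , j) → w (suc i , j))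
    ≡⟨ cong (∑[ j < n ] w (zero , j) +_) (total-*↔× m _) ⟩
  ∑[ j < n ] w (zero , j) + ∑[ i < m ] ∑[ j < n ] w (suc i , j) ∎
  where
  -- `remQuot` as a function of the `splitAt` result, so that `cong` can replace that result.
  remQuot′ : Fin n ⊎ Fin (m * n) → Fin (suc m) × Fin n
  remQuot′ s = Product.swap ([ (_, zero) , Product.map₂ suc ∘ quotRem {m} n ]′ s)

total-× : ∀ {m n} {A B : Set} (e : A ↔ Fin m) (e′ : B ↔ Fin n) (w : A × B → ℕ) →
          total (enumeration-× e e′) w ≡ total e (λ x → total e′ (λ y → w (x , y)))
total-× {m} e e′ w = total-*↔× m (λ (i , j) → w (Inverse.from e i , Inverse.from e′ j))

-- Sums over neighbourhoods

-- Weighting all vertices by the adjacency indicator replaces filtering; the sum is then linear and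
-- splits over product vertex sets.
nbrSum : ∀ {v} (G : SimpleGraph v) → (Vertex G → ℕ) → Vertex G → ℕ
nbrSum G w x = total (enumeration G) (λ y → ι (does (_~?_ G x y)) * w y)

sum-filter-tabulate : ∀ {A : Set} {P : A → Set} (P? : Decidable P) (w : A → ℕ) {n} (g : Fin n → A) →
  ListAction.sum (map w (filter P? (List.tabulate g))) ≡ ∑[ i < n ] (ι (does (P? (g i))) * w (g i))
sum-filter-tabulate P? w {zero}  g = refl
sum-filter-tabulate P? w {suc n} g with does (P? (g zero))
... | true  = cong₂ _+_ (sym (+-identityʳ _)) (sum-filter-tabulate P? w (g ∘ suc))
... | false = sum-filter-tabulate P? w (g ∘ suc)

sum-N : ∀ {v} (G : SimpleGraph v) w x → ListAction.sum (map w (N G x)) ≡ nbrSum G w x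
sum-N G w x = trans
  (cong (ListAction.sum ∘ map w ∘ filter (_~?_ G x)) (map-tabulate id (Inverse.from (enumeration G))))
  (sum-filter-tabulate (_~?_ G x) w (Inverse.from (enumeration G)))

length≡sum-1 : ∀ {A : Set} (xs : List A) → length xs ≡ ListAction.sum (map (λ _ → 1) xs)
length≡sum-1 List.[]       = refl
length≡sum-1 (_ List.∷ xs) = cong suc (length≡sum-1 xs)

degree≡total : ∀ {v} (G : SimpleGraph v) x →
               degree G x ≡ total (enumeration G) (λ y → ι (does (_~?_ G x y)))
degree≡total G x = begin
  degree G x                             ≡⟨ length≡sum-1 (N G x) ⟩
  ListAction.sum (map (λ _ → 1) (N G x))       ≡⟨ sum-N G (λ _ → 1) x ⟩
  nbrSum G (λ _ → 1) x                   ≡⟨ total-*ʳ (enumeration G) (λ y → ι (does (_~?_ G x y))) 1 ⟩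
  total (enumeration G) (λ y → ι (does (_~?_ G x y))) * 1  ≡⟨ trans (*-comm _ 1) (*-identityˡ _) ⟩
  total (enumeration G) (λ y → ι (does (_~?_ G x y)))      ∎

total-ι-≟V : ∀ {v} (G : SimpleGraph v) x → total (enumeration G) (λ y → ι (does (_≟V_ G x y))) ≡ 1
total-ι-≟V G x = trans
  -- `_≟V_` compares images under the enumeration, so at the i-th vertex the indicator compares `x′`
  -- with i.
  (sum-cong-≗ {x = λ i → ι (does (x′ ≟ Inverse.to (enumeration G) (Inverse.from (enumeration G) i)))}
    λ i → cong (λ j → ι (does (x′ ≟ j))) (Inverse.strictlyInverseˡ (enumeration G) i))
  (sum-ι-≟ x′)
  where x′ = Inverse.to (enumeration G) x

ι-∧-* : ∀ b c w → ι (b ∧ c) * w ≡ ι b * (ι c * w)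
ι-∧-* true  c w = sym (+-identityʳ _)
ι-∧-* false c w = refl

-- A vertex sees exactly the blocks other than its own. Writing the number of blocks as `suc p`
-- makes their count `p`, with no subtraction.
nbrSum-H : ∀ {n p Q} (w : Fin (suc p) × Fin n → ℕ) → (∀ i → ∑[ j < n ] w (i , j) ≡ Q) →
           ∀ x → nbrSum H[ n , suc p ] w x ≡ p * Q
nbrSum-H {n} {p} {Q} w blockSum (i , j) = begin
  nbrSum H[ n , suc p ] w (i , j)
    ≡⟨ total-*↔× (suc p) (λ (i′ , j′) → i≢ i′ * w (i′ , j′)) ⟩
  ∑[ i′ < suc p ] ∑[ j′ < n ] (i≢ i′ * w (i′ , j′))
    ≡⟨ sum-cong-≗ (λ i′ → sym (*-distribˡ-sum (i≢ i′) (λ j′ → w (i′ , j′)))) ⟩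
  ∑[ i′ < suc p ] (i≢ i′ * ∑[ j′ < n ] w (i′ , j′))
    ≡⟨ sum-cong-≗ (λ i′ → cong (i≢ i′ *_) (blockSum i′)) ⟩
  ∑[ i′ < suc p ] (i≢ i′ * Q)
    ≡⟨ sym (*-distribʳ-sum Q i≢) ⟩
  sum i≢ * Q
    ≡⟨ cong (_* Q) (sum-ι-≢ i) ⟩
  p * Q ∎
  where
  i≢ : Fin (suc p) → ℕ
  i≢ i′ = ι (not (does (i ≟ i′)))

-- The indicator of `c ≡ c′` factors out of the inner sum, so only the copy containing the vertex
-- contributes.
nbrSum-copies : ∀ {v a K} (H : SimpleGraph v) (w : Fin a × Vertex H → ℕ) →
                (∀ c x → nbrSum H (λ y → w (c , y)) x ≡ K) →
                ∀ x → nbrSum (copies a H) w x ≡ K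
nbrSum-copies {a = a} {K} H w nbrSum≡K (c , h) = begin
  nbrSum (copies a H) w (c , h)
    ≡⟨ total-× (↔-id (Fin a)) (enumeration H) (λ (c′ , h′) → ι (does (c ≟ c′) ∧ h~ h′) * w (c′ , h′)) ⟩
  ∑[ c′ < a ] total (enumeration H) (λ h′ → ι (does (c ≟ c′) ∧ h~ h′) * w (c′ , h′))
    ≡⟨ sum-cong-≗ (λ c′ → total-cong (enumeration H) λ h′ → ι-∧-* (does (c ≟ c′)) (h~ h′) (w (c′ , h′))) ⟩
  ∑[ c′ < a ] total (enumeration H) (λ h′ → c≡ c′ * (ι (h~ h′) * w (c′ , h′)))
    ≡⟨ sum-cong-≗ (λ c′ → total-*ˡ (enumeration H) (c≡ c′) (λ h′ → ι (h~ h′) * w (c′ , h′))) ⟩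
  ∑[ c′ < a ] (c≡ c′ * nbrSum H (λ y → w (c′ , y)) h)
    ≡⟨ sum-cong-≗ (λ c′ → cong (c≡ c′ *_) (nbrSum≡K c′ h)) ⟩
  ∑[ c′ < a ] (c≡ c′ * K)
    ≡⟨ sym (*-distribʳ-sum K c≡) ⟩
  sum c≡ * K
    ≡⟨ cong (_* K) (sum-ι-≟ c) ⟩
  1 * K
    ≡⟨ *-identityˡ K ⟩
  K ∎
  where
  c≡ : Fin a → ℕ
  c≡ c′ = ι (does (c ≟ c′))
  h~ : Vertex H → Bool
  h~ h′ = does (_~?_ H h h′)

-- Exclusiveness is what turns the disjunction into a sum: if both held, the right side could count
-- `w` twice.
ι-∨-∧-* : ∀ {P Q : Set} → ¬ (P × Q) → (P? : Dec P) (Q? : Dec Q) → ∀ b w →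
          ι (does P? ∨ (does Q? ∧ b)) * w ≡ ι (does P?) * w + ι (does Q?) * (ι b * w)
ι-∨-∧-* ¬PQ (yes p) (yes q) b w = contradiction (p , q) ¬PQ
ι-∨-∧-* ¬PQ (yes p) (no _)  b w = sym (+-identityʳ _)
ι-∨-∧-* ¬PQ (no _)  (yes q) b w = sym (+-identityʳ _)
ι-∨-∧-* ¬PQ (no _)  (no _)  b w = refl

-- The neighbours of `(g , h)` are the whole copies of `H` over the `r` neighbours of `g`, and the
-- neighbours of `h` in its own copy. Irreflexivity of `G` keeps the two kinds disjoint.
nbrSum-lexProduct : ∀ {v v′ r S K} (G : SimpleGraph v) (H : SimpleGraph v′) → Regular r G →
                    (w : Vertex G × Vertex H → ℕ) →
                    (∀ g → total (enumeration H) (λ h → w (g , h)) ≡ S) →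
                    (∀ g h → nbrSum H (λ h′ → w (g , h′)) h ≡ K) →
                    ∀ x → nbrSum (lexProduct G H) w x ≡ r * S + K
nbrSum-lexProduct {r = r} {S} {K} G H regular w total≡S nbrSum≡K (g , h) = begin
  nbrSum (lexProduct G H) w (g , h)
    ≡⟨ total-× eG eH (λ (g′ , h′) → ι (does (_~?_ G g g′) ∨ (does (_≟V_ G g g′) ∧ h~ h′)) * w (g′ , h′)) ⟩
  total eG (λ g′ → total eH λ h′ → ι (does (_~?_ G g g′) ∨ (does (_≟V_ G g g′) ∧ h~ h′)) * w (g′ , h′))
    ≡⟨ total-cong eG (λ g′ → total-cong eH λ h′ →
         ι-∨-∧-* (λ { (g~g′ , g≡g′) → ~-irrefl G g≡g′ g~g′ }) (_~?_ G g g′) (_≟V_ G g g′) (h~ h′) (w (g′ , h′))) ⟩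
  total eG (λ g′ → total eH λ h′ → g~ g′ * w (g′ , h′) + g≡ g′ * (ι (h~ h′) * w (g′ , h′)))
    ≡⟨ total-cong eG (λ g′ → total-+ eH (λ h′ → g~ g′ * w (g′ , h′)) (λ h′ → g≡ g′ * (ι (h~ h′) * w (g′ , h′)))) ⟩
  total eG (λ g′ → total eH (λ h′ → g~ g′ * w (g′ , h′)) +
                   total eH (λ h′ → g≡ g′ * (ι (h~ h′) * w (g′ , h′))))
    ≡⟨ total-cong eG (λ g′ → cong₂ _+_ (total-*ˡ eH (g~ g′) (λ h′ → w (g′ , h′)))
                                        (total-*ˡ eH (g≡ g′) (λ h′ → ι (h~ h′) * w (g′ , h′)))) ⟩
  total eG (λ g′ → g~ g′ * total eH (λ h′ → w (g′ , h′)) + g≡ g′ * nbrSum H (λ h′ → w (g′ , h′)) h)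
    ≡⟨ total-cong eG (λ g′ → cong₂ (λ s k → g~ g′ * s + g≡ g′ * k) (total≡S g′) (nbrSum≡K g′ h)) ⟩
  total eG (λ g′ → g~ g′ * S + g≡ g′ * K)
    ≡⟨ total-+ eG (λ g′ → g~ g′ * S) (λ g′ → g≡ g′ * K) ⟩
  total eG (λ g′ → g~ g′ * S) + total eG (λ g′ → g≡ g′ * K)
    ≡⟨ cong₂ _+_ (total-*ʳ eG g~ S) (total-*ʳ eG g≡ K) ⟩
  total eG g~ * S + total eG g≡ * K
    ≡⟨ cong₂ (λ d e → d * S + e * K) (trans (sym (degree≡total G g)) (regular g)) (total-ι-≟V G g) ⟩
  r * S + 1 * K
    ≡⟨ cong (r * S +_) (*-identityˡ K) ⟩
  r * S + K ∎
  where
  eG = enumeration G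
  eH = enumeration H
  g~ g≡ : Vertex G → ℕ
  g~ g′ = ι (does (_~?_ G g g′))
  g≡ g′ = ι (does (_≟V_ G g g′))
  h~ : Vertex H → Bool
  h~ h′ = does (_~?_ H h h′)

-- Permutations with constant sum

-- A Kotzig array: an n by N array whose rows are permutations of 0, ..., N - 1 and whose columns
-- have equal sums.
record Balanced (n N : ℕ) : Set where
  field
    σ          : Fin n → Permutation′ N
    columnSum  : ℕ
    isBalanced : ∀ b → ∑[ j < n ] toℕ (σ j ⟨$⟩ʳ b) ≡ columnSum

toℕ+toℕ-opposite : ∀ {n} (i : Fin n) → suc (toℕ i + toℕ (opposite i)) ≡ n
toℕ+toℕ-opposite i = trans (cong (suc (toℕ i) +_) (opposite-prop i)) (m+[n∸m]≡n (toℕ<n i))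

balanced-[] : ∀ {N} → Balanced 0 N
balanced-[] = record { σ = λ () ; columnSum = 0 ; isBalanced = λ _ → refl }

balanced-pair : ∀ {n N} → Balanced n N → Balanced (2 + n) N
balanced-pair {N = N} B = record
  { σ          = ↔-id _ ∷ reverse ∷ σ
  -- An index and its reversal add up to N - 1. The truncation is harmless, as an index `b` exists
  -- only for positive N.
  ; columnSum  = N ∸ 1 + columnSum
  ; isBalanced = λ b → trans (sym (+-assoc (toℕ b) _ _))
                             (cong₂ _+_ (cong (_∸ 1) (toℕ+toℕ-opposite b)) (isBalanced b))
  }
  where open Balanced B

balanced-pairs : ∀ t {n N} → Balanced n N → Balanced (t * 2 + n) N
balanced-pairs zero    B = B
balanced-pairs (suc t) B = balanced-pair (balanced-pairs t B)

-- Pigeonhole: if `y` were missed, punching it out of the codomain would inject `suc n` points into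
-- `n`.
injective⇒strictlySurjective : ∀ {n} {f : Fin n → Fin n} → Injective _≡_ _≡_ f → StrictlySurjective _≡_ f
injective⇒strictlySurjective {suc n} {f} inj y with any? (λ x → f x ≟ y)
... | yes x,fx≡y = x,fx≡y
... | no  y∉f    = contradiction
  (injective⇒≤ (λ {x} {x′} → inj ∘ punchOut-injective (y≢f x) (y≢f x′)))
  1+n≰n
  where
  y≢f : ∀ x → y ≢ f x
  y≢f x y≡fx = y∉f (x , sym y≡fx)

injective⇒permutation : ∀ {n} (f : Fin n → Fin n) → Injective _≡_ _≡_ f → Permutation′ n
injective⇒permutation f inj = mk↔ₛ′ f (proj₁ ∘ surj) (proj₂ ∘ surj) (λ x → inj (proj₂ (surj (f x))))
  where surj = injective⇒strictlySurjective inj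

m+m≡n+n⇒m≡n : ∀ {m n} → m + m ≡ n + n → m ≡ n
m+m≡n+n⇒m≡n {m} {n} eq = trans (n≡⌊n+n/2⌋ m) (trans (cong ⌊_/2⌋ eq) (sym (n≡⌊n+n/2⌋ n)))

1+m+m≢n+n : ∀ {m n} → ¬ suc (m + m) ≡ n + n
1+m+m≢n+n {m} {n} eq = 1+n≢n (trans eq (cong (λ x → x + x) (sym m≡n)))
  where
  m≡n : m ≡ n
  -- By definition the rounded-up half of `m + m` is the rounded-down half of `suc (m + m)`, so
  -- halving `eq` applies.
  m≡n = trans (n≡⌈n+n/2⌉ m) (trans (cong ⌊_/2⌋ eq) (sym (n≡⌊n+n/2⌋ n)))

-- Three balanced permutations of 2k + 1 points

module _ (k : ℕ) where

  -- The map b ↦ b + k modulo 2k + 1: the first k + 1 points move up by k, and the last k move down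
  -- by k + 1.
  rotate : Permutation′ (suc k + k)
  rotate = cast-id (+-comm k (suc k)) ↔-∘ (↔-sym +↔⊎ ↔-∘ (swap-↔ ↔-∘ +↔⊎ {suc k} {k}))

  -- The excess of b + `rotate` b over k: the first k + 1 points give the even numbers up to 2k, the
  -- others the odd numbers below 2k.
  evenOdd : Fin (suc k) ⊎ Fin k → ℕ
  evenOdd (inj₁ i) = toℕ i + toℕ i
  evenOdd (inj₂ i) = suc (toℕ i + toℕ i)

  evenOdd-< : ∀ s → evenOdd s < suc k + k
  evenOdd-< (inj₁ i) = s≤s (+-mono-≤ (toℕ≤pred[n] i) (toℕ≤pred[n] i))
  evenOdd-< (inj₂ i) = s≤s (+-mono-≤ (toℕ<n i) (<⇒≤ (toℕ<n i)))

  evenOdd-injective : Injective _≡_ _≡_ evenOdd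
  evenOdd-injective {inj₁ i} {inj₁ j} eq = cong inj₁ (toℕ-injective (m+m≡n+n⇒m≡n eq))
  evenOdd-injective {inj₁ i} {inj₂ j} eq = contradiction (sym eq) (1+m+m≢n+n {toℕ j} {toℕ i})
  evenOdd-injective {inj₂ i} {inj₁ j} eq = contradiction eq (1+m+m≢n+n {toℕ i} {toℕ j})
  evenOdd-injective {inj₂ i} {inj₂ j} eq = cong inj₂ (toℕ-injective (m+m≡n+n⇒m≡n (suc-injective eq)))

  interleave : Permutation′ (suc k + k)
  interleave = injective⇒permutation (λ b → fromℕ< (evenOdd-< (splitAt (suc k) b)))
    (Injection.injective (↔⇒↣ +↔⊎) ∘ evenOdd-injective ∘ fromℕ<-injective _ _ _ _)

  -- interleave was chosen to make this hold: b + rotate b runs through k, …, 3k, each once.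
  toℕ+toℕ-rotate : ∀ b → toℕ b + toℕ (rotate ⟨$⟩ʳ b) ≡ k + toℕ (interleave ⟨$⟩ʳ b)
  toℕ+toℕ-rotate b = begin
    toℕ b + toℕ (rotate ⟨$⟩ʳ b)
      ≡⟨ cong₂ _+_ (cong toℕ (sym (join-splitAt (suc k) k b))) (toℕ-cast _ (join k (suc k) (swap s))) ⟩
    toℕ (join (suc k) k s) + toℕ (join k (suc k) (swap s))
      ≡⟨ join+join-swap s ⟩
    k + evenOdd s
      ≡⟨ cong (k +_) (sym (toℕ-fromℕ< (evenOdd-< s))) ⟩
    k + toℕ (interleave ⟨$⟩ʳ b) ∎
    where
    s = splitAt (suc k) b
    join+join-swap : ∀ s → toℕ (join (suc k) k s) + toℕ (join k (suc k) (swap s)) ≡ k + evenOdd s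
    join+join-swap (inj₁ i) = trans
      (cong₂ _+_ (toℕ-↑ˡ i k) (toℕ-↑ʳ k i))
      (x+[k+x] (toℕ i) k)
      where
      x+[k+x] : ∀ x k → x + (k + x) ≡ k + (x + x)
      x+[k+x] = solve-∀
    join+join-swap (inj₂ i) = trans
      (cong₂ _+_ (toℕ-↑ʳ (suc k) i) (toℕ-↑ˡ i (suc k)))
      ([1+k+x]+x (toℕ i) k)
      where
      [1+k+x]+x : ∀ x k → suc (k + x) + x ≡ k + suc (x + x)
      [1+k+x]+x = solve-∀

  balanced-triple : Balanced 3 (suc k + k)
  balanced-triple = record
    -- The first two rows add up to k + c with c = `interleave` b; the third is chosen as 2k - c,
    -- which cancels c and leaves 3k.
    { σ          = ↔-id _ ∷ rotate ∷ (reverse ↔-∘ interleave) ∷ []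
    ; columnSum  = k + (k + k)
    ; isBalanced = λ b → let c = interleave ⟨$⟩ʳ b in begin
        toℕ b + (toℕ (rotate ⟨$⟩ʳ b) + (toℕ (opposite c) + 0))
          ≡⟨ regroup-sum (toℕ b) _ _ ⟩
        (toℕ b + toℕ (rotate ⟨$⟩ʳ b)) + toℕ (opposite c)
          ≡⟨ cong (_+ toℕ (opposite c)) (toℕ+toℕ-rotate b) ⟩
        (k + toℕ c) + toℕ (opposite c)
          ≡⟨ +-assoc k _ _ ⟩
        k + (toℕ c + toℕ (opposite c))
          ≡⟨ cong (k +_) (suc-injective (toℕ+toℕ-opposite c)) ⟩
        k + (k + k) ∎
    }
    where
    regroup-sum : ∀ x y z → x + (y + (z + 0)) ≡ (x + y) + z
    regroup-sum = solve-∀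

-- Balanced families by parity

even⇒balanced : ∀ {n N} → n % 2 ≡ 0 → Balanced n N
even⇒balanced {n} {N} n%2≡0 =
  subst (λ x → Balanced x N) (sym n≡[n/2]*2+0) (balanced-pairs (n / 2) balanced-[])
  where
  n≡[n/2]*2+0 : n ≡ n / 2 * 2 + 0
  n≡[n/2]*2+0 = trans (m≡m%n+[m/n]*n n 2) (trans (cong (_+ n / 2 * 2) n%2≡0) (sym (+-identityʳ _)))

odd⇒≡1+k*2 : ∀ n → n % 2 ≡ 1 → n ≡ 1 + n / 2 * 2
odd⇒≡1+k*2 n n%2≡1 = trans (m≡m%n+[m/n]*n n 2) (cong (_+ n / 2 * 2) n%2≡1)

odd⇒balanced : ∀ {n N} → 1 < n → n % 2 ≡ 1 → N % 2 ≡ 1 → Balanced n N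
odd⇒balanced {n} {N} 1<n n%2≡1 N%2≡1 with n / 2 | odd⇒≡1+k*2 n n%2≡1 | N / 2 | odd⇒≡1+k*2 N N%2≡1
-- Here n = 1, which `1<n` excludes.
... | zero  | refl | _ | _    = contradiction 1<n 1+n≰n
-- Here n = 3 + 2t: one triple followed by t pairs.
... | suc t | refl | k | refl =
  subst₂ Balanced (+-comm (t * 2) 3) (1+k+k≡1+k*2 k) (balanced-pairs t (balanced-triple k))
  where
  1+k+k≡1+k*2 : ∀ k → suc k + k ≡ 1 + k * 2
  1+k+k≡1+k*2 = solve-∀

balanced : ∀ {n N} → 1 < n → (n % 2 ≡ 0) ⊎ (N % 2 ≡ 1) → Balanced n N
balanced     1<n (inj₁ n-even) = even⇒balanced n-even
balanced {n} 1<n (inj₂ N-odd) with n % 2 in eq | m%n<n n 2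
... | 0           | _ = even⇒balanced eq
... | 1           | _ = odd⇒balanced 1<n eq N-odd
... | suc (suc _) | s≤s (s≤s ())

-- The labelling

module Labelling {m a n p} (G : SimpleGraph m) (B : Balanced n (m * (a * p))) where

  open Balanced B

  private
    blocks : ℕ
    blocks = m * (a * p)

    V : Set
    V = Vertex G × (Fin a × (Fin p × Fin n))

  block↔ : (Vertex G × (Fin a × Fin p)) ↔ Fin blocks
  block↔ = enumeration-× (enumeration G) (↔-sym *↔×)

  regroup : V ↔ ((Vertex G × (Fin a × Fin p)) × Fin n)
  regroup = mk↔ₛ′ (λ (g , c , i , j) → (g , c , i) , j) (λ ((g , c , i) , j) → g , c , i , j)
                  (λ _ → refl) (λ _ → refl)

  -- The swap makes `j` the leading digit in base `blocks`. Since `j` is kept, each `σ j` can be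
  -- undone separately.
  permuteBlocks : (Fin blocks × Fin n) ↔ (Fin n × Fin blocks)
  permuteBlocks = mk↔ₛ′ (λ (b , j) → j , (σ j ⟨$⟩ʳ b)) (λ (j , b) → (σ j ⟨$⟩ˡ b) , j)
                        (λ (j , b) → cong (j ,_) (inverseʳ (σ j)))
                        (λ (b , j) → cong (_, j) (inverseˡ (σ j)))

  size : n * blocks ≡ m * (a * (p * n))
  size = trans (*-comm n blocks) (trans (*-assoc m (a * p) n) (cong (m *_) (*-assoc a p n)))

  labelling : V ↔ Fin (m * (a * (p * n)))
  labelling = cast-id size ↔-∘ (↔-sym *↔× ↔-∘ (permuteBlocks ↔-∘ ((block↔ ×-↔ ↔-id (Fin n)) ↔-∘ regroup)))

  w : V → ℕ
  w = label (↔⇒⤖ labelling)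

  Q : ℕ
  Q = ∑[ j < n ] suc (blocks * toℕ j) + columnSum

  blockSum : ∀ g c i → ∑[ j < n ] w (g , c , i , j) ≡ Q
  blockSum g c i = begin
    ∑[ j < n ] w (g , c , i , j)
      -- The chain of bijections computes to a cast of the pair `j`, `σ j ⟨$⟩ʳ b`, with leading
      -- digit `j`.
      ≡⟨ sum-cong-≗ (λ j → cong suc (trans (toℕ-cast size _) (toℕ-combine j (σ j ⟨$⟩ʳ b)))) ⟩
    ∑[ j < n ] (suc (blocks * toℕ j) + toℕ (σ j ⟨$⟩ʳ b))
      ≡⟨ ∑-distrib-+ (λ j → suc (blocks * toℕ j)) (λ j → toℕ (σ j ⟨$⟩ʳ b)) ⟩
    ∑[ j < n ] suc (blocks * toℕ j) + ∑[ j < n ] toℕ (σ j ⟨$⟩ʳ b)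
      ≡⟨ cong (∑[ j < n ] suc (blocks * toℕ j) +_) (isBalanced b) ⟩
    Q ∎
    where b = Inverse.to block↔ (g , c , i)

  -- The fibre over `g` consists of a p blocks, each of sum `Q`.
  copiesSum : ∀ g → total (enumeration (copies a H[ n , p ])) (λ h → w (g , h)) ≡ a * (p * Q)
  copiesSum g = begin
    total (enumeration (copies a H[ n , p ])) (λ h → w (g , h))
      ≡⟨ total-× (↔-id (Fin a)) (enumeration H[ n , p ]) (λ h → w (g , h)) ⟩
    ∑[ c < a ] total (enumeration H[ n , p ]) (λ h → w (g , c , h))
      ≡⟨ sum-cong-≗ (λ c → trans (total-*↔× p _) (sum-cong-≗ (blockSum g c))) ⟩
    ∑[ c < a ] ∑[ i < p ] Q
      ≡⟨ trans (sum-const a _) (cong (a *_) (sum-const p Q)) ⟩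
    a * (p * Q) ∎

theorem12 : (m a n p r : ℕ) → 1 ≤ m → 1 ≤ a → 1 < n → 1 < p →
    (G : SimpleGraph m) → Regular r G →
    (n % 2 ≡ 0) ⊎ ((a * p * m) % 2 ≡ 1) →
    DistanceMagic (lexProduct G (copies a H[ n , p ]))
theorem12 m a n (suc p) r _ _ 1<n _ G regular parity =
  -- Each of the r neighbouring fibres contributes all its blocks; the vertex's own copy contributes
  -- the `p` blocks other than its own.
  ↔⇒⤖ labelling , r * (a * (suc p * Q)) + p * Q , λ x → trans
    (sum-N (lexProduct G (copies a H[ n , suc p ])) w x)
    (nbrSum-lexProduct G (copies a H[ n , suc p ]) regular w copiesSum
      (λ g → nbrSum-copies H[ n , suc p ] (λ h → w (g , h))
        (λ c → nbrSum-H (λ h → w (g , c , h)) (blockSum g c)))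
      x)
  where
  open Labelling {a = a} {p = suc p} G
    (balanced 1<n (map₂ (subst (λ N → N % 2 ≡ 1) (*-comm (a * suc p) m)) parity))
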